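{- Every quadrangulation admits a strong labeling.
   Context: A quadrangulation is a plane graph (a planar graph with a fixed embedding in the plane) that is a maximal bipartite plane graph; equivalently, every face, including the outer face, is bounded by a 4-cycle. Its vertices are properly 2-colored black and white, so the outer face has two black and two white vertices. An angle of a plane graph is a corner of a face at a vertex, i.e. a pair of consecutive edges around a vertex. Each edge $uv$ has four incident angles: the two angles at $u$ on either side of $uv$ and the two angles at $v$ on either side of $uv$. A strong labeling of a quadrangulation $Q$ is a map from the angles of $Q$ to $\{0,1\}$ satisfying: (G0) the two black vertices on the outer face are named $s_0$ and $s_1$, and all angles incident to $s_i$ are labeled $i$; (G1) for each vertex $v\notin\{s_0,s_1\}$, the labels of the angles at $v$, in cyclic order around $v$, form a non-empty interval of 1s and a non-empty interval of 0s; (G2) for each edge, the two incident labels at one endpoint coincide and the two incident labels at the other endpoint differ; (G3$^+_Q$) the labels of the angles in each bounded face are $0011$ in cyclic order, and reading the labels of the angles of the outer face in clockwise order starting at $s_0$ they are also $0011$. -}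

module Defs where

open import Data.Nat using (ℕ; zero; suc; _+_; _<_; _≤_)
open import Data.Fin using (Fin)
open import Data.Bool using (Bool; true; false)
open import Data.Product using (Σ; ∃; _×_; _,_)
open import Data.Sum using (_⊎_)
open import Relation.Binary.PropositionalEquality using (_≡_; _≢_)

iter : {A : Set} → (A → A) → ℕ → A → A
iter f zero    x = x
iter f (suc k) x = f (iter f k x)

-- Plane graphs as combinatorial maps (rotation systems) of genus 0.
--
-- Darts (half-edges) are Fin (ne + ne); vertices Fin nv; faces Fin nf.
--   tail d : the vertex the dart d leaves.
--   α d    : the opposite dart of the same edge (fixed-point-free involution).
--   σ d    : the next dart counterclockwise around tail d (a permutation,
--            with inverse σ⁻; each vertex is exactly one σ-orbit).
-- ANGLES: the angle (corner) "at dart d" is the corner at tail d between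
-- d and σ d.  Hence angles are in bijection with darts.
-- The corner following the corner of d along its face is the corner of
--   φ d = α (σ d),
-- and faces are the φ-orbits (face d is the face containing corner d).
-- Planarity: connected and Euler's formula  nv - ne + nf = 2.
-- With σ counterclockwise, φ walks along each face keeping the face on its
-- right: clockwise around bounded faces and counterclockwise around the
-- outer face; so clockwise around the outer face is φ⁻¹ = σ⁻ ∘ α.

data Walk {D V : Set} (tail : D → V) (α : D → D) : V → V → Set where
  stay : ∀ {v} → Walk tail α v v
  step : ∀ {w} (d : D) → Walk tail α (tail (α d)) w → Walk tail α (tail d) w

record PlaneMap : Set where
  field
    nv ne nf : ℕ
    tail  : Fin (ne + ne) → Fin nv
    α     : Fin (ne + ne) → Fin (ne + ne)
    σ σ⁻  : Fin (ne + ne) → Fin (ne + ne)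
    face  : Fin (ne + ne) → Fin nf
    outer : Fin nf
    α-invol : ∀ d → α (α d) ≡ d
    α-nofix : ∀ d → α d ≢ d
    σ-σ⁻    : ∀ d → σ (σ⁻ d) ≡ d
    σ⁻-σ    : ∀ d → σ⁻ (σ d) ≡ d
    σ-tail  : ∀ d → tail (σ d) ≡ tail d
    σ-trans : ∀ d d′ → tail d ≡ tail d′ → ∃ λ k → iter σ k d ≡ d′
    tail-surj : ∀ v → ∃ λ d → tail d ≡ v
    φ-face    : ∀ d → face (α (σ d)) ≡ face d
    φ-trans   : ∀ d d′ → face d ≡ face d′ → ∃ λ k → iter (λ e → α (σ e)) k d ≡ d′
    face-surj : ∀ f → ∃ λ d → face d ≡ f
    connected : ∀ u v → Walk tail α u v
    euler : nv + nf ≡ ne + 2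

  φ : Fin (ne + ne) → Fin (ne + ne)
  φ d = α (σ d)

  φ⁻ : Fin (ne + ne) → Fin (ne + ne)
  φ⁻ d = σ⁻ (α d)

record Quadrangulation : Set where
  field
    map : PlaneMap
  open PlaneMap map public
  field
    no-loop  : ∀ d → tail (α d) ≢ tail d
    no-multi : ∀ d d′ → tail d ≡ tail d′ → tail (α d) ≡ tail (α d′) → d ≡ d′
    face-4   : ∀ d → iter φ 4 d ≡ d
    face-cyc : ∀ d → let v0 = tail d ; v1 = tail (φ d)
                         v2 = tail (iter φ 2 d) ; v3 = tail (iter φ 3 d) in
                 v0 ≢ v1 × v0 ≢ v2 × v0 ≢ v3 × v1 ≢ v2 × v1 ≢ v3 × v2 ≢ v3

-- a proper 2-colouring: true = black, false = white
ProperColouring : Quadrangulation → Set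
ProperColouring Q = Σ (Fin nv → Bool) λ col → ∀ d → col (tail d) ≢ col (tail (α d))
  where open Quadrangulation Q

-- Strong labelings.  A labeling is λ : darts → Bool, the value at dart d
-- being the label of the angle at d (corner between d and σ d);
-- false = 0, true = 1.

module _ (Q : Quadrangulation) (col : Fin (Quadrangulation.nv Q) → Bool)
         (lab : Fin (Quadrangulation.ne Q + Quadrangulation.ne Q) → Bool) where
  open Quadrangulation Q

  G0 : Fin nv → Fin nv → Set
  G0 s0 s1 =
      s0 ≢ s1 × col s0 ≡ true × col s1 ≡ true
    × (∃ λ d → face d ≡ outer × tail d ≡ s0)
    × (∃ λ d → face d ≡ outer × tail d ≡ s1)
    × (∀ d → tail d ≡ s0 → lab d ≡ false)
    × (∀ d → tail d ≡ s1 → lab d ≡ true)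

  G1 : Fin nv → Fin nv → Set
  G1 s0 s1 = ∀ v → v ≢ s0 → v ≢ s1 →
    ∃ λ d → ∃ λ a → ∃ λ b → tail d ≡ v × 0 < a × 0 < b
      × iter σ (a + b) d ≡ d
      × (∀ i → 0 < i → i < a + b → iter σ i d ≢ d)
      × (∀ i → i < a → lab (iter σ i d) ≡ true)
      × (∀ i → a ≤ i → i < a + b → lab (iter σ i d) ≡ false)

  -- (G2) the edge {d, α d}: the angles incident to it at tail d are those at
  -- d and σ⁻ d; at tail (α d) those at α d and σ⁻ (α d)
  G2 : Set
  G2 = ∀ d →
      (lab d ≡ lab (σ⁻ d) × lab (α d) ≢ lab (σ⁻ (α d)))
    ⊎ (lab d ≢ lab (σ⁻ d) × lab (α d) ≡ lab (σ⁻ (α d)))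

  -- (G3⁺_Q) bounded faces read 0011 cyclically; outer face read clockwise
  -- (i.e. along φ⁻) from s0 reads 0011
  G3 : Fin nv → Set
  G3 s0 =
      (∀ f → f ≢ outer → ∃ λ d → face d ≡ f
          × lab d ≡ false × lab (φ d) ≡ false
          × lab (iter φ 2 d) ≡ true × lab (iter φ 3 d) ≡ true)
    × (∀ d → face d ≡ outer → tail d ≡ s0 →
          lab d ≡ false × lab (φ⁻ d) ≡ false
          × lab (φ⁻ (φ⁻ d)) ≡ true × lab (φ⁻ (φ⁻ (φ⁻ d))) ≡ true)

  IsStrongLabeling : Set
  IsStrongLabeling = ∃ λ s0 → ∃ λ s1 → G0 s0 s1 × G1 s0 s1 × G2 × G3 s0

-- The faces of Q are the edges of a plane graph B on the black vertices, and the
-- white vertices are the faces of B.  A face reads 0011 exactly when opposite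
-- corners differ, so the labels of the black corners amount to an orientation of B
-- (from label 0 to label 1), and G2 then determines the labels of the white corners.
-- B is 2-connected because Q is simple: the black vertices around a white vertex are
-- distinct, so an arc of them is an ear.  Adding ears one at a time gives an
-- st-numbering of B with s₀ and s₁ as extremes, and B is oriented along it.  Every
-- vertex other than s₀, s₁ then has corners of both labels (at a white vertex because
-- heights cannot increase all the way around it), hence at least two label changes.
-- By G2 each edge carries exactly one change, and by Euler's formula there are
-- 2 nv - 4 edges; so every such vertex has exactly two changes, which is G1.

module Submission where

open import Defs
open import Data.Nat.Properties
open import Algebra.Properties.CommutativeMonoid.Sum +-0-commutativeMonoid
  using (sum; sum-cong-≗; ∑-distrib-+; ∑-comm; sum-permute; sum-replicate-zero)
import Data.Bool as Bool
open import Data.Bool using (Bool; true; false; not; if_then_else_; _∨_)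
open import Data.Bool.Properties using (∨-zeroʳ; ¬-not; not-¬; not-involutive)
open import Data.Fin using (Fin; zero; suc; toℕ; combine; remQuot)
open import Data.Fin.Patterns using (0F; 1F; 2F; 3F)
open import Data.Fin.Permutation using (permutation)
import Data.Fin.Properties as Fin
open import Data.Fin.Properties using (toℕ<n; toℕ-injective; any?; injective⇒≤; combine-remQuot)
import Data.List as List
open import Data.List.Relation.Unary.All using (All; []; _∷_)
open import Data.List.Relation.Unary.AllPairs using ([]; _∷_)
open import Data.List.Relation.Unary.Unique.Propositional using (Unique)
open import Data.Nat using (ℕ; zero; suc; _+_; _*_; _∸_; _<_; _≤_; _>_; z≤n; s≤s; s≤s⁻¹)
import Data.Nat.ListAction as ListAction
open import Data.Nat.Tactic.RingSolver using (solve-∀)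
open import Data.Product using (Σ; ∃; _×_; _,_; proj₁; proj₂)
open import Data.Sum using (_⊎_; inj₁; inj₂)
open import Function using (_∘_)
open import Relation.Binary.Definitions using (tri<; tri≈; tri>)
open import Relation.Binary.PropositionalEquality
  using (_≡_; _≢_; refl; sym; trans; cong; cong₂; subst; subst₂; module ≡-Reasoning)
open import Relation.Nullary using (¬_; Dec; yes; no; does; contradiction)
open import Relation.Nullary.Decidable using (_×-dec_; ¬?; dec-true; dec-false)
open import Relation.Unary using (Decidable)

-- Iteration of maps and finite sums.

true≢false : {b : Bool} → b ≡ true → b ≢ false
true≢false refl ()

least : {P : ℕ → Set} → Decidable P → ∀ k → P k → ∃ λ m → P m × (∀ i → i < m → ¬ P i)
least P? zero    p₀ = 0 , p₀ , λ _ ()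
least P? (suc k) pk with P? 0
... | yes p₀ = 0 , p₀ , λ _ ()
... | no ¬p₀ with least (P? ∘ suc) k pk
...   | m , pm , below = suc m , pm , λ { zero _ → ¬p₀ ; (suc i) (s≤s i<m) → below i i<m }

module _ {A : Set} (f : A → A) where

  iter-shift : ∀ k x → iter f k (f x) ≡ f (iter f k x)
  iter-shift zero    x = refl
  iter-shift (suc k) x = cong f (iter-shift k x)

  iter-+ : ∀ j k x → iter f (j + k) x ≡ iter f j (iter f k x)
  iter-+ zero    k x = refl
  iter-+ (suc j) k x = cong f (iter-+ j k x)

  iter-injective : (∀ {x y} → f x ≡ f y → x ≡ y) → ∀ k {x y} → iter f k x ≡ iter f k y → x ≡ y
  iter-injective f-inj zero    eq = eq
  iter-injective f-inj (suc k) eq = iter-injective f-inj k (f-inj eq)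

  iter-periodic : ∀ {m x} → 0 < m → iter f m x ≡ x → ∀ k → ∃ λ i → i < m × iter f k x ≡ iter f i x
  iter-periodic 0<m period zero = 0 , 0<m , refl
  iter-periodic {m} 0<m period (suc k) with iter-periodic 0<m period k
  ... | i , i<m , eq with m≤n⇒m<n∨m≡n i<m
  ...   | inj₁ 1+i<m = suc i , 1+i<m , cong f eq
  ...   | inj₂ refl  = 0 , 0<m , trans (cong f eq) period

  switch : (b : A → Bool) → ∀ k x → b x ≡ true → b (iter f k x) ≡ false →
           ∃ λ j → b (iter f j x) ≡ true × b (f (iter f j x)) ≡ false
  switch b zero    x bx end = contradiction end (true≢false bx)
  switch b (suc k) x bx end with b (iter f k x) in eq
  ... | true  = k , eq , end
  ... | false = switch b k x bx eq

-- Transitivity chains the steps into `g` of the last point `⊏` `g x`, which irreflexivity forbids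
-- on a closed orbit. The relation is a parameter so that both rising and falling heights are
-- covered.
acyclic : ∀ {A : Set} (f : A → A) (_⊏_ : ℕ → ℕ → Set) → (∀ {x y z} → x ⊏ y → y ⊏ z → x ⊏ z) →
          (g : A → ℕ) → (∀ {i} → ¬ i ⊏ i) → ∀ {x n} →
          (∀ k → g (f (iter f k x)) ⊏ g (iter f k x)) → iter f (suc n) x ≢ x
acyclic f _⊏_ ⊏-trans g irrefl {x} {n} descends closed =
  irrefl (subst (λ y → g y ⊏ g x) closed (below n))
  where
  below : ∀ n → g (iter f (suc n) x) ⊏ g x
  below zero    = descends 0
  below (suc n) = ⊏-trans (descends (suc n)) (below n)

sum-mono : ∀ {n} {f g : Fin n → ℕ} → (∀ i → f i ≤ g i) → sum f ≤ sum g
sum-mono {zero}  le = z≤n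
sum-mono {suc n} le = +-mono-≤ (le zero) (sum-mono (le ∘ suc))

sum-mono-< : ∀ {n} {f g : Fin n → ℕ} → (∀ i → f i ≤ g i) → ∀ i → f i < g i → sum f < sum g
sum-mono-< le zero    lt = +-mono-<-≤ lt (sum-mono (le ∘ suc))
sum-mono-< le (suc i) lt = +-mono-≤-< (le zero) (sum-mono-< (le ∘ suc) i lt)

δ : ∀ {n} → Fin n → ℕ → Fin n → ℕ
δ x c i = if does (x Fin.≟ i) then c else 0

sum-δ : ∀ {n} (x : Fin n) c → sum (δ x c) ≡ c
sum-δ {suc n} zero    c = trans (cong (c +_) (sum-replicate-zero n)) (+-identityʳ c)
sum-δ         (suc x) c = sum-δ x c

sum-fibres : ∀ {m n} (t : Fin m → Fin n) (w : Fin m → ℕ) →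
             sum w ≡ sum (λ v → sum (λ d → δ (t d) (w d) v))
sum-fibres t w = trans (sum-cong-≗ (λ d → sym (sum-δ (t d) (w d)))) (∑-comm (λ d → δ (t d) (w d)))

-- Induction with a changing weight: the head's weight is set to zero and split off from the total
-- by `δ`. The remaining entries differ from the head, so their weights stay the same.
sum-unique : ∀ {n} (w : Fin n → ℕ) {xs} → Unique xs → ListAction.sum (List.map w xs) ≤ sum w
sum-unique w []                         = z≤n
sum-unique {n} w (_∷_ {x} {xs} x∉xs unique) = begin
  w x + ListAction.sum (List.map w xs)   ≡⟨ cong (w x +_) (agree x∉xs) ⟩
  w x + ListAction.sum (List.map w∖x xs) ≤⟨ +-monoʳ-≤ (w x) (sum-unique w∖x unique) ⟩
  w x + sum w∖x                    ≡⟨ cong (_+ sum w∖x) (sym (sum-δ x (w x))) ⟩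
  sum (δ x (w x)) + sum w∖x        ≡⟨ sym (∑-distrib-+ (δ x (w x)) w∖x) ⟩
  sum (λ i → δ x (w x) i + w∖x i)  ≡⟨ sum-cong-≗ split ⟩
  sum w                            ∎
  where
  open ≤-Reasoning
  w∖x : Fin n → ℕ
  w∖x i = if does (x Fin.≟ i) then 0 else w i
  split : ∀ i → δ x (w x) i + w∖x i ≡ w i
  split i with x Fin.≟ i
  ... | yes refl = +-identityʳ (w x)
  ... | no _     = refl
  agree : ∀ {ys} → All (x ≢_) ys → ListAction.sum (List.map w ys) ≡ ListAction.sum (List.map w∖x ys)
  agree []                    = refl
  agree (_∷_ {y} x≢y x∉ys) with x Fin.≟ y
  ... | yes x≡y = contradiction x≡y x≢y
  ... | no _    = cong (w y +_) (agree x∉ys)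

sum-const : ∀ n c → sum {n} (λ _ → c) ≡ n * c
sum-const zero    c = refl
sum-const (suc n) c = cong (c +_) (sum-const n c)

δ-self : ∀ {n} (x : Fin n) c → δ x c x ≡ c
δ-self x c rewrite dec-true (x Fin.≟ x) refl = refl

-- The termination measure for adding ears.
missing : ∀ {n} → (Fin n → Bool) → ℕ
missing S = sum (λ v → if S v then 0 else 1)

missing-< : ∀ {n} (S S′ : Fin n → Bool) → (∀ {v} → S v ≡ true → S′ v ≡ true) →
            ∀ x → S x ≡ false → S′ x ≡ true → missing S′ < missing S
missing-< S S′ grows x x∉S x∈S′ = sum-mono-< le x lt
  where
  le : ∀ v → (if S′ v then 0 else 1) ≤ (if S v then 0 else 1)
  le v with S v | S′ v | grows {v}
  ... | false | false | _ = ≤-refl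
  ... | false | true  | _ = z≤n
  ... | true  | true  | _ = z≤n
  ... | true  | false | g = contradiction (g refl) λ ()
  lt : (if S′ x then 0 else 1) < (if S x then 0 else 1)
  lt rewrite x∉S | x∈S′ = s≤s z≤n

-- Partial st-numberings and their extension by ears.

module STNumbering {n : ℕ} (Adj : Fin n → Fin n → Set)
                   (adj-sym : ∀ {x y} → Adj x y → Adj y x) (s t : Fin n) where

  -- An st-numbering of the subgraph induced on `S`. Heights may coincide; `breakTies` separates
  -- them.
  record IsSTNumbering (S : Fin n → Bool) (h : Fin n → ℕ) : Set where
    field
      s∈S    : S s ≡ true
      t∈S    : S t ≡ true
      lower  : ∀ {v} → S v ≡ true → v ≢ s → ∃ λ u → Adj v u × S u ≡ true × h u < h v
      higher : ∀ {v} → S v ≡ true → v ≢ t → ∃ λ u → Adj v u × S u ≡ true × h v < h u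
      s-min  : ∀ {v} → S v ≡ true → v ≢ s → h s < h v
      t-max  : ∀ {v} → S v ≡ true → v ≢ t → h v < h t

  rescale : ∀ {S h} (h′ : Fin n → ℕ) → (∀ {u v} → h u < h v → h′ u < h′ v) →
            IsSTNumbering S h → IsSTNumbering S h′
  rescale h′ mono N = record
    { s∈S    = s∈S
    ; t∈S    = t∈S
    ; lower  = λ v∈S v≢s → let u , vu , u∈S , lt = lower v∈S v≢s in u , vu , u∈S , mono lt
    ; higher = λ v∈S v≢t → let u , vu , u∈S , lt = higher v∈S v≢t in u , vu , u∈S , mono lt
    ; s-min  = λ v∈S v≢s → mono (s-min v∈S v≢s)
    ; t-max  = λ v∈S v≢t → mono (t-max v∈S v≢t)
    }
    where open IsSTNumbering N

  respects : ∀ {S S′ h} → (∀ v → S v ≡ S′ v) → IsSTNumbering S h → IsSTNumbering S′ h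
  respects {S} {S′} S≗S′ N = record
    { s∈S    = into s∈S
    ; t∈S    = into t∈S
    ; lower  = λ v∈S v≢s → let u , vu , u∈S , lt = lower (back v∈S) v≢s in u , vu , into u∈S , lt
    ; higher = λ v∈S v≢t → let u , vu , u∈S , lt = higher (back v∈S) v≢t in u , vu , into u∈S , lt
    ; s-min  = λ v∈S v≢s → s-min (back v∈S) v≢s
    ; t-max  = λ v∈S v≢t → t-max (back v∈S) v≢t
    }
    where
    open IsSTNumbering N
    into : ∀ {v} → S v ≡ true → S′ v ≡ true
    into {v} v∈S = trans (sym (S≗S′ v)) v∈S
    back : ∀ {v} → S′ v ≡ true → S v ≡ true
    back {v} v∈S = trans (S≗S′ v) v∈S

  module _ (h : Fin n → ℕ) where

    -- Encodes the lexicographic order on pairs of height and index, the index being less than `n`.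
    breakTies : Fin n → ℕ
    breakTies v = h v * n + toℕ v

    breakTies-mono : ∀ {u v} → h u < h v → breakTies u < breakTies v
    breakTies-mono {u} {v} lt = begin-strict
      h u * n + toℕ u  <⟨ +-monoʳ-< (h u * n) (toℕ<n u) ⟩
      h u * n + n      ≡⟨ +-comm (h u * n) n ⟩
      suc (h u) * n    ≤⟨ *-monoˡ-≤ n lt ⟩
      h v * n          ≤⟨ m≤m+n _ _ ⟩
      h v * n + toℕ v  ∎
      where open ≤-Reasoning

    breakTies-injective : ∀ {u v} → breakTies u ≡ breakTies v → u ≡ v
    breakTies-injective {u} {v} eq with <-cmp (h u) (h v)
    ... | tri< lt _ _ = contradiction eq (<⇒≢ (breakTies-mono lt))
    ... | tri> _ _ gt = contradiction (sym eq) (<⇒≢ (breakTies-mono gt))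
    ... | tri≈ _ e _  = toℕ-injective (+-cancelˡ-≡ (h u * n) _ _
                          (trans eq (cong (λ z → z * n + toℕ v) (sym e))))

  -- The inner vertices are `p 1` to `p k`, and the ends are `p 0` and `p (suc k)`.
  record Ear (S : Fin n → Bool) : Set where
    field
      p        : ℕ → Fin n
      k        : ℕ
      nonempty : 0 < k
      start    : S (p 0) ≡ true
      end      : S (p (suc k)) ≡ true
      ends≢    : p 0 ≢ p (suc k)
      fresh    : ∀ i → i < k → S (p (suc i)) ≡ false
      distinct : ∀ i j → i < k → j < k → p (suc i) ≡ p (suc j) → i ≡ j
      adjacent : ∀ i → i ≤ k → Adj (p i) (p (suc i))

  reverse : ∀ {S} → Ear S → Ear S
  reverse {S} ear = record
    { p        = λ i → p (suc k ∸ i)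
    ; k        = k
    ; nonempty = nonempty
    ; start    = end
    ; end      = trans (cong (S ∘ p) (n∸n≡0 k)) start
    ; ends≢    = λ eq → ends≢ (trans (cong p (sym (n∸n≡0 k))) (sym eq))
    ; fresh    = λ i i<k → trans (cong (S ∘ p) (flip i i<k)) (fresh _ (flip< i i<k))
    ; distinct = λ i j i<k j<k eq → suc-injective (∸-cancelˡ-≡ i<k j<k
                   (distinct _ _ (flip< i i<k) (flip< j j<k)
                     (trans (cong p (sym (flip i i<k))) (trans eq (cong p (flip j j<k))))))
    ; adjacent = λ i i≤k → adj-sym (subst (λ x → Adj (p (k ∸ i)) (p x)) (sym (+-∸-assoc 1 i≤k))
                   (adjacent (k ∸ i) (m∸n≤m k i)))
    }
    where
    open Ear ear
    flip : ∀ i → i < k → k ∸ i ≡ suc (k ∸ suc i)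
    flip i i<k = +-∸-assoc 1 i<k
    flip< : ∀ i → i < k → k ∸ suc i < k
    flip< i i<k = ≤-trans (≤-reflexive (sym (flip i i<k))) (m∸n≤m k i)

  record Extension (S : Fin n → Bool) : Set where
    field
      S′      : Fin n → Bool
      h′      : Fin n → ℕ
      numbers : IsSTNumbering S′ h′
      grows   : ∀ {v} → S v ≡ true → S′ v ≡ true
      new     : Fin n
      new∉S   : S new ≡ false
      new∈S′  : S′ new ≡ true

  module Rising {S h} (N : IsSTNumbering S h) (ear : Ear S)
                (rises : h (Ear.p ear 0) < h (Ear.p ear (suc (Ear.k ear)))) where
    open IsSTNumbering N
    open Ear ear

    onEar? : ∀ v → Dec (∃ λ i → i < k × p (suc i) ≡ v)
    onEar? v = anyUpTo? (λ i → p (suc i) Fin.≟ v) k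

    S′ : Fin n → Bool
    S′ v = S v ∨ does (onEar? v)

    -- The ear occupies the gap between h (p 0) and h (p 0) + 1, subdivided into suc k parts.
    M : ℕ
    M = suc k

    h′ : Fin n → ℕ
    h′ v with S v | onEar? v
    ... | true  | _           = h v * M
    ... | false | yes (i , _) = h (p 0) * M + suc i
    -- Arbitrary value outside `S′`.
    ... | false | no _        = 0

    h′-old : ∀ {v} → S v ≡ true → h′ v ≡ h v * M
    h′-old {v} v∈S with S v | onEar? v
    ... | true | _ = refl

    h′-ear : ∀ i → i ≤ k → h′ (p i) ≡ h (p 0) * M + i
    h′-ear zero    _   = trans (h′-old start) (sym (+-identityʳ _))
    h′-ear (suc i) i<k with S (p (suc i)) | fresh i i<k | onEar? (p (suc i))
    -- The search may return a different index for the same vertex; `distinct` identifies the two.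
    ... | false | _ | yes (j , j<k , eq) = cong (λ x → h (p 0) * M + suc x) (distinct j i j<k i<k eq)
    ... | false | _ | no ¬on             = contradiction (i , i<k , refl) ¬on

    grows : ∀ {v} → S v ≡ true → S′ v ≡ true
    grows v∈S rewrite v∈S = refl

    S′-ear : ∀ i → i ≤ suc k → S′ (p i) ≡ true
    S′-ear zero    _         = grows start
    S′-ear (suc i) (s≤s i≤k) with m≤n⇒m<n∨m≡n i≤k
    ... | inj₂ refl = grows end
    ... | inj₁ i<k with onEar? (p (suc i))
    ...   | yes _  = ∨-zeroʳ _
    ...   | no ¬on = contradiction (i , i<k , refl) ¬on

    S′-cases : ∀ {v} → S′ v ≡ true → (S v ≡ true) ⊎ (∃ λ i → i < k × p (suc i) ≡ v)
    S′-cases {v} v∈S′ with S v | onEar? v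
    ... | true  | _      = inj₁ refl
    ... | false | yes on = inj₂ on

    old< : ∀ {u v} → S u ≡ true → S v ≡ true → h u < h v → h′ u < h′ v
    old< u∈S v∈S lt rewrite h′-old u∈S | h′-old v∈S = *-monoˡ-< M lt

    -- An offset `i` below `M` stays under the next multiple of `M`, and by `rises` that multiple is
    -- at most the scaled height of the far end.
    ear<end : ∀ i → i ≤ k → h′ (p i) < h′ (p (suc k))
    ear<end i i≤k = begin-strict
      h′ (p i)           ≡⟨ h′-ear i i≤k ⟩
      h (p 0) * M + i    <⟨ +-monoʳ-< _ (s≤s i≤k) ⟩
      h (p 0) * M + M    ≡⟨ +-comm _ M ⟩
      suc (h (p 0)) * M  ≤⟨ *-monoˡ-≤ M rises ⟩
      h (p (suc k)) * M  ≡⟨ sym (h′-old end) ⟩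
      h′ (p (suc k))     ∎
      where open ≤-Reasoning

    ear-rises : ∀ i → i ≤ k → h′ (p i) < h′ (p (suc i))
    ear-rises i i≤k with m≤n⇒m<n∨m≡n i≤k
    ... | inj₂ refl = ear<end i i≤k
    ... | inj₁ i<k  = subst₂ _<_ (sym (h′-ear i i≤k)) (sym (h′-ear (suc i) i<k))
                        (+-monoʳ-< _ (n<1+n i))

    start<ear : ∀ i → i < k → h′ (p 0) < h′ (p (suc i))
    start<ear i i<k = subst₂ _<_ (sym (h′-ear 0 z≤n)) (sym (h′-ear (suc i) i<k))
                        (+-monoʳ-< _ (s≤s z≤n))

    s≤ : ∀ {v} → S v ≡ true → h′ s ≤ h′ v
    s≤ {v} v∈S with v Fin.≟ s
    ... | yes refl = ≤-refl
    ... | no v≢s   = <⇒≤ (old< s∈S v∈S (s-min v∈S v≢s))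

    ≤t : ∀ {v} → S v ≡ true → h′ v ≤ h′ t
    ≤t {v} v∈S with v Fin.≟ t
    ... | yes refl = ≤-refl
    ... | no v≢t   = <⇒≤ (old< v∈S t∈S (t-max v∈S v≢t))

    lower′ : ∀ {v} → S′ v ≡ true → v ≢ s → ∃ λ u → Adj v u × S′ u ≡ true × h′ u < h′ v
    lower′ v∈S′ v≢s with S′-cases v∈S′
    ... | inj₁ v∈S = let u , vu , u∈S , lt = lower v∈S v≢s in u , vu , grows u∈S , old< u∈S v∈S lt
    ... | inj₂ (i , i<k , refl) =
      p i , adj-sym (adjacent i (<⇒≤ i<k)) , S′-ear i (m≤n⇒m≤1+n (<⇒≤ i<k)) , ear-rises i (<⇒≤ i<k)

    higher′ : ∀ {v} → S′ v ≡ true → v ≢ t → ∃ λ u → Adj v u × S′ u ≡ true × h′ v < h′ u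
    higher′ v∈S′ v≢t with S′-cases v∈S′
    ... | inj₁ v∈S = let u , vu , u∈S , lt = higher v∈S v≢t in u , vu , grows u∈S , old< v∈S u∈S lt
    ... | inj₂ (i , i<k , refl) =
      p (suc (suc i)) , adjacent (suc i) i<k , S′-ear (suc (suc i)) (s≤s i<k) , ear-rises (suc i) i<k

    s-min′ : ∀ {v} → S′ v ≡ true → v ≢ s → h′ s < h′ v
    s-min′ v∈S′ v≢s with S′-cases v∈S′
    ... | inj₁ v∈S = old< s∈S v∈S (s-min v∈S v≢s)
    ... | inj₂ (i , i<k , refl) = ≤-<-trans (s≤ start) (start<ear i i<k)

    t-max′ : ∀ {v} → S′ v ≡ true → v ≢ t → h′ v < h′ t
    t-max′ v∈S′ v≢t with S′-cases v∈S′
    ... | inj₁ v∈S = old< v∈S t∈S (t-max v∈S v≢t)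
    ... | inj₂ (i , i<k , refl) = <-≤-trans (ear<end (suc i) i<k) (≤t end)

    extension : Extension S
    extension = record
      { S′      = S′
      ; h′      = h′
      ; numbers = record
        { s∈S = grows s∈S ; t∈S = grows t∈S ; lower = lower′ ; higher = higher′
        ; s-min = s-min′ ; t-max = t-max′ }
      ; grows   = grows
      ; new     = p 1
      ; new∉S   = fresh 0 nonempty
      ; new∈S′  = S′-ear 1 (s≤s z≤n)
      }

  -- Once ties are broken, the two ends of the ear have different heights, so the ear rises in one
  -- of its two directions.
  extend : ∀ {S h} → IsSTNumbering S h → Ear S → Extension S
  extend {S} {h} N ear with <-cmp (breakTies h (p 0)) (breakTies h (p (suc k)))
    where open Ear ear
  ... | tri< lt _ _ = Rising.extension (rescale (breakTies h) (breakTies-mono h) N) ear lt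
  ... | tri≈ _ eq _ = contradiction (breakTies-injective h eq) (Ear.ends≢ ear)
  ... | tri> _ _ gt = Rising.extension (rescale (breakTies h) (breakTies-mono h) N) (reverse ear)
                        (subst (breakTies h (p (suc k)) <_) (cong (breakTies h ∘ p) (sym (n∸n≡0 k))) gt)
    where open Ear ear

-- The graph on the black vertices, with the faces as edges.

module Coloured (Q : Quadrangulation) (colouring : ProperColouring Q) where
  open Quadrangulation Q

  col : Fin nv → Bool
  col = proj₁ colouring

  Dart : Set
  Dart = Fin (ne + ne)

  Black White : Dart → Set
  Black d = col (tail d) ≡ true
  White d = col (tail d) ≡ false

  colour : ∀ d → Black d ⊎ White d
  colour d with col (tail d)
  ... | true  = inj₁ refl
  ... | false = inj₂ refl

  -- For a black d, the face of d is an edge of the black graph, from tail d to opp d.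
  opp : Dart → Fin nv
  opp d = tail (φ (φ d))

  α-injective : ∀ {d e} → α d ≡ α e → d ≡ e
  α-injective {d} {e} eq = trans (sym (α-invol d)) (trans (cong α eq) (α-invol e))

  σ-injective : ∀ {d e} → σ d ≡ σ e → d ≡ e
  σ-injective {d} {e} eq = trans (sym (σ⁻-σ d)) (trans (cong σ⁻ eq) (σ⁻-σ e))

  tail-σ : ∀ k d → tail (iter σ k d) ≡ tail d
  tail-σ zero    d = refl
  tail-σ (suc k) d = trans (σ-tail _) (tail-σ k d)

  col-α : ∀ d → col (tail (α d)) ≡ not (col (tail d))
  col-α d = ¬-not (proj₂ colouring d ∘ sym)

  col-φ : ∀ d → col (tail (φ d)) ≡ not (col (tail d))
  col-φ d = trans (col-α (σ d)) (cong (not ∘ col) (σ-tail d))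

  col-opp : ∀ d → col (opp d) ≡ col (tail d)
  col-opp d = trans (col-φ (φ d)) (trans (cong not (col-φ d)) (not-involutive _))

  -- Faces have length 4, so three steps of `φ` are one step back. Hence the fourth corner of the
  -- face of `d` lies at the other endpoint of the edge of `d`.
  σφ³ : ∀ d → σ (iter φ 3 d) ≡ α d
  σφ³ d = α-injective (trans (face-4 d) (sym (α-invol d)))

  φσ⁻ : ∀ d → φ (σ⁻ d) ≡ α d
  φσ⁻ d = cong α (σ-σ⁻ d)

  φφ⁻ : ∀ d → φ (φ⁻ d) ≡ d
  φφ⁻ d = trans (φσ⁻ (α d)) (α-invol d)

  opp-opp : ∀ d → opp (φ (φ d)) ≡ tail d
  opp-opp d = cong tail (face-4 d)

  tail≢opp : ∀ d → tail d ≢ opp d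
  tail≢opp d = let _ , ne , _ = face-cyc d in ne

  period : ∀ d → ∃ λ n → iter σ (suc n) d ≡ d × (∀ i → i < n → iter σ (suc i) d ≢ d)
  period d = let k , eq = σ-trans (σ d) d (σ-tail d)
             in least (λ n → iter σ (suc n) d Fin.≟ d) k (trans (sym (iter-shift σ k d)) eq)

  Adj : Fin nv → Fin nv → Set
  Adj x y = ∃ λ d → Black d × tail d ≡ x × opp d ≡ y

  adj-sym : ∀ {x y} → Adj x y → Adj y x
  adj-sym (d , black , eq , eq′) = φ (φ d) , trans (col-opp d) black , eq′ , trans (opp-opp d) eq

  -- Finding ears, and the st-numbering of the black graph.

  module _ (s t : Fin nv) (s~t : Adj s t) where
    open STNumbering Adj adj-sym s t

    module FindEar {S h} (N : IsSTNumbering S h) where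
      open IsSTNumbering N

      neighbour : ∀ {u} → S u ≡ true → ∃ λ d → Black d × tail d ≡ u × S (opp d) ≡ true
      neighbour {u} u∈S with u Fin.≟ s
      ... | yes refl = let d , black , eq , eq′ = s~t in d , black , eq , trans (cong S eq′) t∈S
      ... | no u≢s   = let v , (d , black , eq , eq′) , v∈S , _ = lower u∈S u≢s
                       in d , black , eq , trans (cong S eq′) v∈S

      S-black : ∀ {u} → S u ≡ true → col u ≡ true
      S-black u∈S = let d , black , eq , _ = neighbour u∈S in trans (cong col (sym eq)) black

      head : Dart → Bool
      head d = S (tail (α d))

      head-white : ∀ {d} → head d ≡ true → White d
      head-white {d} d∈ = trans (cong (col ∘ tail) (sym (α-invol d)))
                            (trans (col-α (α d)) (cong not (S-black d∈)))

      -- Two different visited vertices and an unvisited one around a common vertex. That vertex is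
      -- white, since `S` has only black vertices, and an arc around it will be the ear.
      Good : Dart → Dart → Dart → Set
      Good a b c = tail a ≡ tail c × tail b ≡ tail c × tail (α a) ≢ tail (α b)
                 × head a ≡ true × head b ≡ true × head c ≡ false

      good? : Dec (∃ λ a → ∃ λ b → ∃ λ c → Good a b c)
      good? = any? λ a → any? λ b → any? λ c →
        (tail a Fin.≟ tail c) ×-dec (tail b Fin.≟ tail c) ×-dec ¬? (tail (α a) Fin.≟ tail (α b))
        ×-dec (head a Bool.≟ true) ×-dec (head b Bool.≟ true) ×-dec (head c Bool.≟ false)

      -- Invariant along the walk: the current vertex is visited or has a visited neighbour. It
      -- fails at the target, so some step leads from a vertex with a visited neighbour to an
      -- unvisited one.
      boundary : ∀ {u y} → Walk tail α u y → (S u ≡ true) ⊎ (∃ λ a → tail a ≡ u × head a ≡ true) →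
                 col y ≡ true → S y ≡ false →
                 ∃ λ a → ∃ λ c → tail a ≡ tail c × head a ≡ true × head c ≡ false
      boundary stay (inj₁ u∈S) _ y∉S = contradiction y∉S (true≢false u∈S)
      boundary stay (inj₂ (a , refl , a∈)) y-black _ = contradiction (head-white a∈) (true≢false y-black)
      boundary (step d walk) (inj₁ u∈S) = boundary walk (inj₂ (α d , refl , trans (cong (S ∘ tail) (α-invol d)) u∈S))
      boundary (step d walk) (inj₂ (a , eq , a∈)) y-black y∉S with head d in d∈
      ... | true  = boundary walk (inj₁ d∈) y-black y∉S
      ... | false = a , d , eq , a∈ , d∈

      -- Suppose there is no good triple, and let `u` be the visited end of the dart `a` from
      -- `boundary`. Rotating around `u`, each white neighbour has an unvisited neighbour, which
      -- forces the opposite black vertex of the next face to be unvisited, which in turn is an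
      -- unvisited neighbour of the next white vertex. So every `opp` around `u` is unvisited,
      -- against `neighbour`.
      good-exists : ∀ y → col y ≡ true → S y ≡ false → ∃ λ a → ∃ λ b → ∃ λ c → Good a b c
      good-exists y y-black y∉S with good? | boundary (connected s y) (inj₁ s∈S) y-black y∉S
      ... | yes good | _ = good
      ... | no ¬good | a , c , ac , a∈ , c∉ = contradiction opp∉ (true≢false opp∈)
        where
        x₀ : Dart
        x₀ = α a

        -- Were opp x visited, then tail x, opp x and the unvisited vertex would form a good
        -- triple around tail (α x).
        opp-fresh : ∀ x → tail x ≡ tail x₀ → (∃ λ c → tail c ≡ tail (α x) × head c ≡ false) →
                    S (opp x) ≡ false
        opp-fresh x x-at-u (c , cx , c∉) with S (opp x) in opp∈
        ... | false = refl
        ... | true  = contradiction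
          (α x , iter φ 3 x , c , sym cx , trans tail-φ³ (sym cx)
          , (λ eq → tail≢opp x (trans (sym (cong tail (α-invol x))) (trans eq tail-αφ³)))
          , trans (cong (S ∘ tail) (α-invol x)) (trans (cong S x-at-u) a∈)
          , trans (cong S tail-αφ³) opp∈
          , c∉)
          ¬good
          where
          tail-φ³ : tail (iter φ 3 x) ≡ tail (α x)
          tail-φ³ = trans (sym (σ-tail _)) (cong tail (σφ³ x))
          tail-αφ³ : tail (α (iter φ 3 x)) ≡ opp x
          tail-αφ³ = trans (cong tail (α-invol _)) (σ-tail _)

        unvisited : ∀ k → ∃ λ c → tail c ≡ tail (α (iter σ k x₀)) × head c ≡ false
        unvisited zero    = c , trans (sym ac) (cong tail (sym (α-invol a))) , c∉
        -- The next white vertex is the tail of `φ x`, and `σ (φ x)` leads from it to `opp x`.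
        unvisited (suc k) = σ (φ x) , σ-tail _ , opp-fresh x (tail-σ k x₀) (unvisited k)
          where x = iter σ k x₀

        d : Dart
        d = proj₁ (neighbour a∈)
        opp∈ : S (opp d) ≡ true
        opp∈ = proj₂ (proj₂ (proj₂ (neighbour a∈)))
        turn : ∃ λ k → iter σ k x₀ ≡ d
        turn = σ-trans x₀ d (sym (proj₁ (proj₂ (proj₂ (neighbour a∈)))))
        opp∉ : S (opp d) ≡ false
        opp∉ = subst (λ x → S (opp x) ≡ false) (proj₂ turn)
                 (opp-fresh _ (tail-σ (proj₁ turn) x₀) (unvisited (proj₁ turn)))

      -- The ear: the black vertices around a white vertex, from e up to the next visited one.
      module Arc {e g : Dart} (white : White e) (e∈ : head e ≡ true) (σe∉ : head (σ e) ≡ false)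
                 (ge : tail g ≡ tail e) (g∈ : head g ≡ true) (g≢e : tail (α g) ≢ tail (α e)) where

        p : ℕ → Fin nv
        p i = tail (α (iter σ i e))

        -- Simplicity of `Q` enters here: a dart is determined by its two endpoints.
        p≡⇒turn≡ : ∀ i j → p i ≡ p j → iter σ i e ≡ iter σ j e
        p≡⇒turn≡ i j = no-multi _ _ (trans (tail-σ i e) (sym (tail-σ j e)))

        -- Consecutive neighbours of a white vertex are the two black corners of the face between
        -- them.
        p-adjacent : ∀ i → Adj (p i) (p (suc i))
        p-adjacent i = iter φ 3 x , black , tail-φ³ , cong tail (face-4 (φ x))
          where
          x = iter σ i e
          tail-φ³ : tail (iter φ 3 x) ≡ p i
          tail-φ³ = trans (sym (σ-tail _)) (cong tail (σφ³ x))
          black : Black (iter φ 3 x)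
          black = trans (cong col tail-φ³)
                    (trans (col-α x) (cong not (trans (cong col (tail-σ i e)) white)))

        turn : ∃ λ j → iter σ j e ≡ g
        turn = σ-trans e g (sym ge)

        some-visited : ∃ λ k → S (p (suc k)) ≡ true
        some-visited with turn
        ... | zero  , refl = contradiction refl g≢e
        ... | suc k , refl = k , g∈

        first : ∃ λ k → S (p (suc k)) ≡ true × (∀ i → i < k → S (p (suc i)) ≢ true)
        first = least (λ k → S (p (suc k)) Bool.≟ true) (proj₁ some-visited) (proj₂ some-visited)

        k : ℕ
        k = proj₁ first
        fresh : ∀ i → i < k → S (p (suc i)) ≡ false
        fresh i i<k = ¬-not (proj₂ (proj₂ first) i i<k)

        -- Otherwise the rotation closes up after `suc k` turns, so `g` is `e` or one of the darts
        -- to fresh vertices; its visited far end, different from that of `e`, excludes both.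
        ends≢ : p 0 ≢ p (suc k)
        ends≢ eq with iter-periodic σ (s≤s z≤n) (sym (p≡⇒turn≡ 0 (suc k) eq)) (proj₁ turn)
        ... | zero  , _       , back = g≢e (cong (tail ∘ α) (trans (sym (proj₂ turn)) back))
        ... | suc i , s≤s i<k , back = contradiction (fresh i i<k)
                (true≢false (trans (cong head (trans (sym back) (proj₂ turn))) g∈))

        -- Cancelling `suc i` turns shows that `e` recurs after `j ∸ i` turns, where the far end is
        -- fresh, although the far end of `e` is visited.
        distinct< : ∀ i j → j < k → i < j → p (suc i) ≢ p (suc j)
        distinct< i j j<k i<j eq = contradiction (fresh _ (≤-<-trans (m∸n≤m j (suc i)) j<k))
          (true≢false (trans (cong head (sym back)) e∈))
          where
          shift : suc i + suc (j ∸ suc i) ≡ suc j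
          shift = trans (+-suc (suc i) _) (cong suc (m+[n∸m]≡n i<j))
          back : e ≡ iter σ (suc (j ∸ suc i)) e
          back = iter-injective σ σ-injective (suc i) (begin
            iter σ (suc i) e                              ≡⟨ p≡⇒turn≡ (suc i) (suc j) eq ⟩
            iter σ (suc j) e                              ≡⟨ cong (λ z → iter σ z e) (sym shift) ⟩
            iter σ (suc i + suc (j ∸ suc i)) e            ≡⟨ iter-+ σ (suc i) _ e ⟩
            iter σ (suc i) (iter σ (suc (j ∸ suc i)) e)   ∎)
            where open ≡-Reasoning

        distinct : ∀ i j → i < k → j < k → p (suc i) ≡ p (suc j) → i ≡ j
        distinct i j i<k j<k eq with <-cmp i j
        ... | tri< i<j _ _ = contradiction eq (distinct< i j j<k i<j)
        ... | tri≈ _ i≡j _ = i≡j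
        ... | tri> _ _ j<i = contradiction (sym eq) (distinct< j i i<k j<i)

        nonempty : 0 < k
        nonempty = n≢0⇒n>0 λ k≡0 → contradiction σe∉
          (true≢false (subst (λ k → S (p (suc k)) ≡ true) k≡0 (proj₁ (proj₂ first))))

        ear : Ear S
        ear = record
          { p = p ; k = k ; nonempty = nonempty ; start = e∈ ; end = proj₁ (proj₂ first)
          ; ends≢ = ends≢ ; fresh = fresh ; distinct = distinct ; adjacent = λ i _ → p-adjacent i }

      -- Between `a` and `c` some `e` with a visited far end is followed by a dart with an unvisited
      -- one. At least one of `a` and `b` has a far end other than that of `e`, and it serves as
      -- `g`, which guarantees a second end for the ear.
      find-ear : ∀ y → col y ≡ true → S y ≡ false → Ear S
      find-ear y y-black y∉S with good-exists y y-black y∉S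
      ... | a , b , c , ac , bc , a≢b , a∈ , b∈ , c∉
        with σ-trans a c ac
      ...   | k , refl with switch σ head k a a∈ c∉
      ...     | j , e∈ , σe∉ with tail (α a) Fin.≟ tail (α (iter σ j a))
      ...       | no a≢e  = Arc.ear (head-white e∈) e∈ σe∉ (sym (tail-σ j a)) a∈ a≢e
      ...       | yes a≡e = Arc.ear (head-white e∈) e∈ σe∉
                  (trans bc (trans (sym ac) (sym (tail-σ j a)))) b∈
                  (λ b≡e → a≢b (trans a≡e (sym b≡e)))

    Complete : Set
    Complete = ∃ (IsSTNumbering col)

    -- Each ear lowers `missing S`, which `fuel` bounds. When no black vertex is left out, `S` is
    -- the black colour class, because visited vertices are black.
    complete : ∀ fuel {S h} → missing S < fuel → IsSTNumbering S h → Complete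
    complete (suc fuel) {S} {h} (s≤s bound) N
      with any? (λ v → (col v Bool.≟ true) ×-dec (S v Bool.≟ false))
    ... | no none = h , respects S≗col N
      where
      S≗col : ∀ v → S v ≡ col v
      S≗col v with S v in v∈S | col v in v-col
      ... | true  | true  = refl
      ... | false | false = refl
      ... | true  | false = contradiction v-col (true≢false (FindEar.S-black N v∈S))
      ... | false | true  = contradiction (v , v-col , v∈S) none
    ... | yes (y , y-black , y∉S) = complete fuel (<-≤-trans shrinks bound) numbers
      where
      open Extension (extend N (FindEar.find-ear N y y-black y∉S))
      shrinks : missing S′ < missing S
      shrinks = missing-< S S′ grows new new∉S new∈S′

    s≢t : s ≢ t
    s≢t eq = let d , _ , ds , dt = s~t in tail≢opp d (trans ds (trans eq (sym dt)))

    ends : Fin nv → Bool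
    ends v = does (v Fin.≟ s) ∨ does (v Fin.≟ t)

    endHeight : Fin nv → ℕ
    endHeight v = if does (v Fin.≟ s) then 0 else 1

    initial : IsSTNumbering ends endHeight
    initial = record
      { s∈S    = s∈ends
      ; t∈S    = t∈ends
      ; lower  = λ v∈ends v≢s → case-t v∈ends v≢s (s , adj-sym s~t , s∈ends , s<t)
      ; higher = λ v∈ends v≢t → case-s v∈ends v≢t (t , s~t , t∈ends , s<t)
      ; s-min  = λ v∈ends v≢s → case-t v∈ends v≢s s<t
      ; t-max  = λ v∈ends v≢t → case-s v∈ends v≢t s<t
      }
      where
      s∈ends : ends s ≡ true
      s∈ends rewrite dec-true (s Fin.≟ s) refl = refl
      t∈ends : ends t ≡ true
      t∈ends rewrite dec-true (t Fin.≟ t) refl = ∨-zeroʳ _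
      s<t : endHeight s < endHeight t
      s<t rewrite dec-true (s Fin.≟ s) refl | dec-false (t Fin.≟ s) (s≢t ∘ sym) = s≤s z≤n
      case-t : ∀ {v} {P : Fin nv → Set} → ends v ≡ true → v ≢ s → P t → P v
      case-t {v} v∈ends v≢s pt with v Fin.≟ s | v Fin.≟ t
      ... | yes v≡s | _        = contradiction v≡s v≢s
      ... | no _    | yes refl = pt
      case-s : ∀ {v} {P : Fin nv → Set} → ends v ≡ true → v ≢ t → P s → P v
      case-s {v} v∈ends v≢t ps with v Fin.≟ s | v Fin.≟ t
      ... | yes refl | _       = ps
      ... | no _     | yes v≡t = contradiction v≡t v≢t

    st-numbering : Complete
    st-numbering = complete (suc (missing ends)) ≤-refl initial

-- Counting corners and label changes.

module Counting (Q : Quadrangulation) (colouring : ProperColouring Q) where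
  open Quadrangulation Q
  open Coloured Q colouring

  face-iter : ∀ k d → face (iter φ k d) ≡ face d
  face-iter zero    d = refl
  face-iter (suc k) d = trans (φ-face _) (face-iter k d)

  corners-distinct : ∀ d (i j : Fin 4) → iter φ (toℕ i) d ≡ iter φ (toℕ j) d → i ≡ j
  corners-distinct d i j eq = go i j (cong tail eq)
    where
    go : ∀ i j → tail (iter φ (toℕ i) d) ≡ tail (iter φ (toℕ j) d) → i ≡ j
    go i j eq with face-cyc d
    go 0F 0F eq | _ = refl
    go 1F 1F eq | _ = refl
    go 2F 2F eq | _ = refl
    go 3F 3F eq | _ = refl
    go 0F 1F eq | n , _ = contradiction eq n
    go 0F 2F eq | _ , n , _ = contradiction eq n
    go 0F 3F eq | _ , _ , n , _ = contradiction eq n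
    go 1F 2F eq | _ , _ , _ , n , _ = contradiction eq n
    go 1F 3F eq | _ , _ , _ , _ , n , _ = contradiction eq n
    go 2F 3F eq | _ , _ , _ , _ , _ , n = contradiction eq n
    go 1F 0F eq | n , _ = contradiction (sym eq) n
    go 2F 0F eq | _ , n , _ = contradiction (sym eq) n
    go 3F 0F eq | _ , _ , n , _ = contradiction (sym eq) n
    go 2F 1F eq | _ , _ , _ , n , _ = contradiction (sym eq) n
    go 3F 1F eq | _ , _ , _ , _ , n , _ = contradiction (sym eq) n
    go 3F 2F eq | _ , _ , _ , _ , _ , n = contradiction (sym eq) n

  corner : Fin nf × Fin 4 → Dart
  corner (f , i) = iter φ (toℕ i) (proj₁ (face-surj f))

  corner-face : ∀ f i → face (corner (f , i)) ≡ f
  corner-face f i = trans (face-iter (toℕ i) _) (proj₂ (face-surj f))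

  corner-injective : ∀ {x y} → corner x ≡ corner y → x ≡ y
  corner-injective {f , i} {g , j} eq
    with refl ← trans (sym (corner-face f i)) (trans (cong face eq) (corner-face g j))
    = cong (f ,_) (corners-distinct _ i j eq)

  -- Each face has four different corners and no two faces share one. With Euler's formula this
  -- bounds `ne` by `2 nv - 4`.
  4nf≤2ne : nf * 4 ≤ ne + ne
  4nf≤2ne = injective⇒≤ {f = corner ∘ remQuot 4} λ {x} {y} eq →
    trans (sym (combine-remQuot {nf} 4 x))
      (trans (cong (λ (f , i) → combine f i) (corner-injective eq)) (combine-remQuot {nf} 4 y))

  module _ (lab : Dart → Bool) (g2 : G2 Q col lab) (s t : Fin nv)
           (some : ∀ v → v ≢ s → v ≢ t → ∀ b → ∃ λ d → tail d ≡ v × lab d ≡ b) where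

    change : Dart → ℕ
    change d = if does (lab d Bool.≟ lab (σ⁻ d)) then 0 else 1

    changes-once : ∀ d → change d + change (α d) ≡ 1
    changes-once d with lab d Bool.≟ lab (σ⁻ d) | lab (α d) Bool.≟ lab (σ⁻ (α d)) | g2 d
    ... | yes _  | no _  | _ = refl
    ... | no _   | yes _ | _ = refl
    ... | yes _  | yes eq | inj₁ (_ , ne) = contradiction eq ne
    ... | yes eq | yes _  | inj₂ (ne , _) = contradiction eq ne
    ... | no ne  | no _   | inj₁ (eq , _) = contradiction eq ne
    ... | no _   | no ne  | inj₂ (_ , eq) = contradiction eq ne

    -- Summing `changes-once` over all darts counts every change twice, since `α` permutes the
    -- darts.
    total : sum change ≡ ne
    total = *-cancelʳ-≡ _ _ 2 (trans (double (sum change)) (trans (begin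
      sum change + sum change        ≡⟨ cong (sum change +_)
                                          (sum-permute change (permutation α α α-invol α-invol)) ⟩
      sum change + sum (change ∘ α)  ≡⟨ sym (∑-distrib-+ change (change ∘ α)) ⟩
      sum (λ d → change d + change (α d)) ≡⟨ sum-cong-≗ changes-once ⟩
      sum {ne + ne} (λ _ → 1)        ≡⟨ sum-const (ne + ne) 1 ⟩
      (ne + ne) * 1                  ≡⟨ *-identityʳ _ ⟩
      ne + ne                        ∎) (sym (double ne))))
      where
      open ≡-Reasoning
      double : ∀ x → x * 2 ≡ x + x
      double = solve-∀

    Switch : Bool → Dart → Set
    Switch b d = lab (σ⁻ d) ≡ not b × lab d ≡ b

    switch-change : ∀ {b d} → Switch b d → change d ≡ 1
    switch-change {b} {d} (before , after) with lab d Bool.≟ lab (σ⁻ d)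
    ... | no _   = refl
    ... | yes eq = contradiction (trans (sym after) (trans eq before)) (not-¬ refl)

    switches : ∀ v → v ≢ s → v ≢ t → ∀ b → ∃ λ d → tail d ≡ v × Switch b d
    switches v v≢s v≢t b with some v v≢s v≢t (not b) | some v v≢s v≢t b
    ... | d , refl , ld | d′ , d′v , ld′ with σ-trans d d′ (sym d′v)
    ...   | k , refl with switch σ (λ x → does (lab x Bool.≟ not b)) k d
                            (dec-true (_ Bool.≟ _) ld)
                            (dec-false (_ Bool.≟ _) (not-¬ ld′))
    ...     | j , before , after = σ x , tail-σ (suc j) d
            , trans (cong lab (σ⁻-σ x)) (from-true (lab x Bool.≟ not b) before)
            , trans (¬-not (from-false (lab (σ x) Bool.≟ not b) after)) (not-involutive b)
      where
      x = iter σ j d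
      from-true : ∀ {P : Set} (p : Dec P) → does p ≡ true → P
      from-true (yes p) _ = p
      from-false : ∀ {P : Set} (p : Dec P) → does p ≡ false → ¬ P
      from-false (no ¬p) _ = ¬p

    changesAt : Fin nv → ℕ
    changesAt v = sum (λ d → δ (tail d) (change d) v)

    at-switch : ∀ {v b d} → tail d ≡ v → Switch b d → δ (tail d) (change d) v ≡ 1
    at-switch {d = d} refl sw = trans (δ-self (tail d) _) (switch-change sw)

    true≢false-dart : ∀ {d e} → lab d ≡ true → lab e ≡ false → d ≢ e
    true≢false-dart ld le refl = contradiction le (true≢false ld)

    -- A switch to `true` and a switch to `false` occur at different darts, as their labels differ.
    two-changes : ∀ v → v ≢ s → v ≢ t → 2 ≤ changesAt v
    two-changes v v≢s v≢t with switches v v≢s v≢t true | switches v v≢s v≢t false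
    ... | x , xv , sx | z , zv , sz = subst (_≤ changesAt v)
      (cong₂ _+_ (at-switch xv sx) (cong (_+ 0) (at-switch zv sz)))
      (sum-unique (λ d → δ (tail d) (change d) v)
        ((true≢false-dart (proj₂ sx) (proj₂ sz) ∷ []) ∷ [] ∷ []))

    three-changes : ∀ {v x y} → v ≢ s → v ≢ t → tail x ≡ v → tail y ≡ v →
                    Switch true x → Switch true y → x ≢ y → 2 < changesAt v
    three-changes {v} v≢s v≢t xv yv sx sy x≢y with switches v v≢s v≢t false
    ... | z , zv , sz = subst (_≤ changesAt v)
      (cong₂ _+_ (at-switch xv sx) (cong₂ _+_ (at-switch yv sy) (cong (_+ 0) (at-switch zv sz))))
      (sum-unique (λ d → δ (tail d) (change d) v)
        ((x≢y ∷ true≢false-dart (proj₂ sx) (proj₂ sz) ∷ [])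
          ∷ (true≢false-dart (proj₂ sy) (proj₂ sz) ∷ []) ∷ [] ∷ []))

    -- The extremes s and t need not see any change, so both are credited with two.
    credited : Fin nv → ℕ
    credited v = changesAt v + (δ s 2 v + δ t 2 v)

    credited-total : sum credited ≡ ne + 4
    credited-total = begin
      sum credited
        ≡⟨ ∑-distrib-+ changesAt (λ v → δ s 2 v + δ t 2 v) ⟩
      sum changesAt + sum (λ v → δ s 2 v + δ t 2 v)
        ≡⟨ cong₂ _+_ (trans (sym (sum-fibres tail change)) total) (∑-distrib-+ (δ s 2) (δ t 2)) ⟩
      ne + (sum (δ s 2) + sum (δ t 2))
        ≡⟨ cong (ne +_) (cong₂ _+_ (sum-δ s 2) (sum-δ t 2)) ⟩
      ne + 4                                       ∎
      where open ≡-Reasoning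

    credited≥2 : ∀ v → 2 ≤ credited v
    credited≥2 v with s Fin.≟ v | t Fin.≟ v
    ... | yes _  | _      = m≤n⇒m≤o+n _ (m≤m+n 2 _)
    ... | no _   | yes _  = m≤n⇒m≤o+n _ ≤-refl
    ... | no s≢v | no t≢v = m≤n⇒m≤n+o _ (two-changes v (s≢v ∘ sym) (t≢v ∘ sym))

    -- All credits are at least 2 and sum to `ne + 4`. A third change would make the bound strict,
    -- `2 nv < ne + 4`, contradicting Euler's formula together with `4nf≤2ne`.
    few-changes : ∀ v → ¬ 2 < changesAt v
    few-changes v many = <-irrefl euler×4 (begin-strict
      nv * 4 + nf * 4           ≤⟨ +-monoʳ-≤ (nv * 4) 4nf≤2ne ⟩
      nv * 4 + (ne + ne)        ≡⟨ cong (_+ (ne + ne)) (split nv) ⟩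
      nv * 2 + nv * 2 + (ne + ne) <⟨ +-monoˡ-< (ne + ne) (+-mono-< 2nv< 2nv<) ⟩
      ne + 4 + (ne + 4) + (ne + ne) ∎)
      where
      open ≤-Reasoning
      split : ∀ x → x * 4 ≡ x * 2 + x * 2
      split = solve-∀
      regroup : ∀ x → (x + 2) * 4 ≡ x + 4 + (x + 4) + (x + x)
      regroup = solve-∀
      2nv< : nv * 2 < ne + 4
      2nv< = subst₂ _<_ (sum-const nv 2) credited-total
               (sum-mono-< {f = λ _ → 2} credited≥2 v (m≤n⇒m≤n+o _ many))
      euler×4 : nv * 4 + nf * 4 ≡ ne + 4 + (ne + 4) + (ne + ne)
      euler×4 = trans (sym (*-distribʳ-+ 4 nv nf)) (trans (cong (_* 4) euler) (regroup ne))

    unique-switch : ∀ {v x y} → v ≢ s → v ≢ t → tail x ≡ v → tail y ≡ v →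
                    Switch true x → Switch true y → x ≡ y
    unique-switch {v} {x} {y} v≢s v≢t xv yv sx sy with x Fin.≟ y
    ... | yes x≡y = x≡y
    ... | no x≢y  = contradiction (three-changes v≢s v≢t xv yv sx sy x≢y) (few-changes v)

    -- Start at the switch `d` to `true` and let `a` be the first index with label `false`. A return
    -- to `true` before the rotation closes would be a second switch to `true`, which
    -- `unique-switch` excludes.
    intervals : G1 Q col lab s t
    intervals v v≢s v≢t with switches v v≢s v≢t true | some v v≢s v≢t false
    ... | d , dv , before , after | z , zv , z-false
      with σ-trans d z (trans dv (sym zv)) | period d
    ...   | k , refl | n , closed , minimal
      with least (λ i → lab (iter σ i d) Bool.≟ false) k z-false
    ...     | a , a-false , trues = d , a , suc n ∸ a , dv , 0<a , m<n⇒0<n∸m a<n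
            , trans (cong (λ i → iter σ i d) a+b≡n) closed
            , (λ { (suc i) _ lt → minimal i (s≤s⁻¹ (subst (suc i <_) a+b≡n lt)) })
            , (λ i i<a → ¬-not (trues i i<a))
            , (λ i a≤i lt → subst (λ i → lab (iter σ i d) ≡ false) (m∸n+n≡m a≤i)
                (falses (i ∸ a) (subst₂ _<_ (sym (m∸n+n≡m a≤i)) a+b≡n lt)))
      where
      0<a : 0 < a
      0<a = n≢0⇒n>0 λ a≡0 → contradiction (subst (λ i → lab (iter σ i d) ≡ false) a≡0 a-false) (true≢false after)
      -- Reducing `a` modulo the period `suc n` gives an index with label `false`, which by
      -- minimality is not below `a`.
      a<n : a < suc n
      a<n with iter-periodic σ (s≤s z≤n) closed a
      ... | i , i<n , eq = ≤-<-trans (≮⇒≥ λ i<a → trues i i<a (trans (cong lab (sym eq)) a-false)) i<n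
      a+b≡n : a + (suc n ∸ a) ≡ suc n
      a+b≡n = m+[n∸m]≡n (<⇒≤ a<n)
      falses : ∀ j → j + a < suc n → lab (iter σ (j + a) d) ≡ false
      falses zero    _  = a-false
      falses (suc j) (s≤s lt) = ¬-not λ j-true → minimal (j + a) lt (unique-switch v≢s v≢t
        (trans (tail-σ (suc j + a) d) dv) dv
        (trans (cong lab (σ⁻-σ _)) (falses j (m≤n⇒m≤1+n lt)) , j-true) (before , after))

-- The labeling obtained from an st-numbering.

module Labelling (Q : Quadrangulation) (colouring : ProperColouring Q) where
  open Quadrangulation Q
  open Coloured Q colouring

  black-corner : ∀ f → ∃ λ d → face d ≡ f × Black d
  black-corner f with face-surj f
  ... | d , df with colour d
  ...   | inj₁ black = d , df , black
  ...   | inj₂ white = φ d , trans (φ-face d) df , trans (col-φ d) (cong not white)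

  module Oriented (s t : Fin nv) (s~t : Adj s t) (h : Fin nv → ℕ)
           (N : STNumbering.IsSTNumbering Adj adj-sym s t col h)
           (h-injective : ∀ {u v} → h u ≡ h v → u ≡ v) where
    open STNumbering.IsSTNumbering N

    -- Label 1 (true) is put at the upper of the two black corners of a face.
    orient : Dart → Bool
    orient d = does (h (opp d) <? h (tail d))

    -- A white corner copies the black corner after it along φ, as the clockwise reading
    -- 0011 of the outer face from s demands.
    lab : Dart → Bool
    lab d = if col (tail d) then orient d else orient (φ d)

    lab-black : ∀ {d} → Black d → lab d ≡ orient d
    lab-black black rewrite black = refl

    lab-white : ∀ {d} → White d → lab d ≡ lab (φ d)
    lab-white {d} white rewrite white | trans (col-φ d) (cong not white) = refl

    orient-true : ∀ {d} → h (opp d) < h (tail d) → orient d ≡ true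
    orient-true = dec-true (_ <? _)

    orient-false : ∀ {d} → h (tail d) < h (opp d) → orient d ≡ false
    orient-false = dec-false (_ <? _) ∘ <-asym

    orient-opp : ∀ d → orient (φ (φ d)) ≡ not (orient d)
    orient-opp d with <-cmp (h (opp d)) (h (tail d))
    ... | tri≈ _ eq _ = contradiction (sym (h-injective eq)) (tail≢opp d)
    ... | tri< lt _ _ = trans (orient-false (subst (λ x → h (opp d) < h x) (sym (opp-opp d)) lt))
                          (sym (cong not (orient-true lt)))
    ... | tri> _ _ gt = trans (orient-true (subst (λ x → h x < h (opp d)) (sym (opp-opp d)) gt))
                          (sym (cong not (orient-false gt)))

    lab-opp : ∀ d → lab (φ (φ d)) ≡ not (lab d)
    lab-opp d with col (tail d) in d-col
    ... | true  rewrite trans (col-opp d) d-col = orient-opp d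
    ... | false rewrite trans (col-opp d) d-col = orient-opp (φ d)

    lab-σ⁻α : ∀ {d} → Black d → lab (σ⁻ (α d)) ≡ lab d
    lab-σ⁻α {d} black = trans (lab-white white) (cong lab (φφ⁻ d))
      where
      white : White (σ⁻ (α d))
      white = trans (cong col (trans (sym (σ-tail _)) (cong tail (σ-σ⁻ (α d))))) (trans (col-α d) (cong not black))

    lab-α : ∀ {d} → Black d → lab (α d) ≡ not (lab (σ⁻ d))
    lab-α {d} black = trans (lab-white (trans (col-α d) (cong not black)))
                        (trans (cong (lab ∘ φ) (sym (φσ⁻ d))) (lab-opp (σ⁻ d)))

    -- On one side of the edge the two labels agree (`lab-σ⁻α`), on the other they are opposite
    -- (`lab-α`). Hence exactly one endpoint sees a change.
    g2-black : ∀ d → Black d → (lab d ≡ lab (σ⁻ d) × lab (α d) ≢ lab (σ⁻ (α d)))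
                             ⊎ (lab d ≢ lab (σ⁻ d) × lab (α d) ≡ lab (σ⁻ (α d)))
    g2-black d black with lab d Bool.≟ lab (σ⁻ d)
    ... | yes eq = inj₁ (eq , λ eq′ → not-¬ eq (trans (sym (lab-σ⁻α black)) (trans (sym eq′) (lab-α black))))
    ... | no ne  = inj₂ (ne , trans (lab-α black) (trans (sym (¬-not ne)) (sym (lab-σ⁻α black))))

    g2 : G2 Q col lab
    g2 d with colour d
    ... | inj₁ black = g2-black d black
    ... | inj₂ white with g2-black (α d) (trans (col-α d) (cong not white))
    ...   | inj₁ (eq , ne) rewrite α-invol d = inj₂ (ne , eq)
    ...   | inj₂ (ne , eq) rewrite α-invol d = inj₁ (eq , ne)

    orient-true⁻¹ : ∀ d → orient d ≡ true → h (opp d) < h (tail d)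
    orient-true⁻¹ d eq with <-cmp (h (opp d)) (h (tail d))
    ... | tri< lt _ _  = lt
    ... | tri≈ _ eq′ _ = contradiction (sym (h-injective eq′)) (tail≢opp d)
    ... | tri> _ _ gt  = contradiction (orient-false gt) (true≢false eq)

    orient-false⁻¹ : ∀ d → orient d ≡ false → h (tail d) < h (opp d)
    orient-false⁻¹ d eq with <-cmp (h (opp d)) (h (tail d))
    ... | tri< lt _ _  = contradiction eq (true≢false (orient-true lt))
    ... | tri≈ _ eq′ _ = contradiction (sym (h-injective eq′)) (tail≢opp d)
    ... | tri> _ _ gt  = gt

    -- With a constant label, h would be strictly monotone all the way around v.
    some-white : ∀ v → col v ≡ false → ∀ b → ∃ λ d → tail d ≡ v × lab d ≡ b
    some-white v v-white b with any? (λ d → (tail d Fin.≟ v) ×-dec (lab d Bool.≟ b)) | tail-surj v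
    ... | yes found | _        = found
    ... | no none   | e , refl with period e
    ...   | n , closed , _ = contradiction closed (cycle b refl)
      where
      orient-around : ∀ k → orient (φ (iter σ k e)) ≡ not b
      orient-around k = trans (sym (trans (lab-white white) (lab-black (trans (col-φ _) (cong not white)))))
                          (¬-not λ eq → none (iter σ k e , tail-σ k e , eq))
        where
        white : White (iter σ k e)
        white = trans (cong col (tail-σ k e)) v-white
      -- Thus `orient (φ x)` compares the heights at the far ends of the consecutive darts `σ x` and
      -- `x`.
      opp-φ : ∀ k → opp (φ (iter σ k e)) ≡ tail (α (iter σ k e))
      opp-φ k = trans (sym (σ-tail _)) (cong tail (σφ³ _))
      height : Dart → ℕ
      height = h ∘ tail ∘ α
      -- All labels at `v` are `not b`: for `b` equal to `true` the heights fall at each turn,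
      -- otherwise they rise.
      cycle : ∀ b′ → b ≡ b′ → iter σ (suc n) e ≢ e
      cycle true  refl = acyclic σ _<_ <-trans height (<-irrefl refl) {n = n} λ k →
        subst (h (tail (φ (iter σ k e))) <_) (cong h (opp-φ k)) (orient-false⁻¹ _ (orient-around k))
      cycle false refl = acyclic σ _>_ (λ p q → <-trans q p) height (<-irrefl refl) {n = n} λ k →
        subst (_< h (tail (φ (iter σ k e)))) (cong h (opp-φ k)) (orient-true⁻¹ _ (orient-around k))

    some-black : ∀ v → col v ≡ true → v ≢ s → v ≢ t → ∀ b → ∃ λ d → tail d ≡ v × lab d ≡ b
    some-black v v-black v≢s v≢t true =
      let u , (d , black , dv , du) , _ , lt = lower v-black v≢s
      in d , dv , trans (lab-black black) (orient-true (subst₂ _<_ (cong h (sym du)) (cong h (sym dv)) lt))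
    some-black v v-black v≢s v≢t false =
      let u , (d , black , dv , du) , _ , lt = higher v-black v≢t
      in d , dv , trans (lab-black black) (orient-false (subst₂ _<_ (cong h (sym dv)) (cong h (sym du)) lt))

    some : ∀ v → v ≢ s → v ≢ t → ∀ b → ∃ λ d → tail d ≡ v × lab d ≡ b
    some v v≢s v≢t with col v in v-col
    ... | true  = some-black v v-col v≢s v≢t
    ... | false = some-white v v-col

    lab-s : ∀ d → tail d ≡ s → lab d ≡ false
    lab-s d refl = trans (lab-black s∈S) (orient-false (s-min (trans (col-opp d) s∈S) (tail≢opp d ∘ sym)))

    lab-t : ∀ d → tail d ≡ t → lab d ≡ true
    lab-t d refl = trans (lab-black t∈S) (orient-true (t-max (trans (col-opp d) t∈S) (tail≢opp d ∘ sym)))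

    -- The word starts at the white corner before `d`, which copies the 0 of `d`; the white corner
    -- after `d` copies the 1 of the opposite black corner.
    bounded : ∀ d → Black d → lab d ≡ false → ∃ λ e → face e ≡ face d
              × lab e ≡ false × lab (φ e) ≡ false × lab (φ (φ e)) ≡ true × lab (φ (φ (φ e))) ≡ true
    bounded d black d-false = iter φ 3 d , trans (φ-face _) (trans (φ-face _) (φ-face d))
      , trans φ³ (trans (cong lab (face-4 d)) d-false)
      , trans (cong lab (face-4 d)) d-false
      , trans (cong (lab ∘ φ) (face-4 d)) φ¹
      , trans (cong (lab ∘ φ ∘ φ) (face-4 d)) φ²
      where
      φ² : lab (φ (φ d)) ≡ true
      φ² = trans (lab-opp d) (cong not d-false)
      φ¹ : lab (φ d) ≡ true
      φ¹ = trans (lab-white (trans (col-φ d) (cong not black))) φ²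
      φ³ : lab (iter φ 3 d) ≡ lab (iter φ 4 d)
      φ³ = lab-white (trans (col-φ _) (cong not (trans (col-opp d) black)))

    g3 : G3 Q col lab s
    g3 = inner , outside
      where
      inner : ∀ f → f ≢ outer → ∃ λ d → face d ≡ f
              × lab d ≡ false × lab (φ d) ≡ false × lab (φ (φ d)) ≡ true × lab (φ (φ (φ d))) ≡ true
      inner f _ with black-corner f
      ... | d , refl , black with lab d in d-lab
      ...   | false = bounded d black d-lab
      -- The opposite black corner carries the label 0.
      ...   | true  = let e , e-face , labels = bounded (φ (φ d)) (trans (col-opp d) black)
                                                  (trans (lab-opp d) (cong not d-lab))
                      in e , trans e-face (trans (φ-face _) (φ-face d)) , labels
      outside : ∀ d → face d ≡ outer → tail d ≡ s → lab d ≡ false × lab (φ⁻ d) ≡ false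
                × lab (φ⁻ (φ⁻ d)) ≡ true × lab (φ⁻ (φ⁻ (φ⁻ d))) ≡ true
      outside d _ ds = lab-s d ds , trans (lab-σ⁻α black) (lab-s d ds) , φ⁻²-lab
        , trans (lab-σ⁻α φ⁻²-black) φ⁻²-lab
        where
        black : Black d
        black = trans (cong col ds) s∈S
        round : φ (φ (φ⁻ (φ⁻ d))) ≡ d
        round = trans (cong φ (φφ⁻ (φ⁻ d))) (φφ⁻ d)
        φ⁻²-black : Black (φ⁻ (φ⁻ d))
        φ⁻²-black = trans (sym (col-opp _)) (trans (cong (col ∘ tail) round) black)
        φ⁻²-lab : lab (φ⁻ (φ⁻ d)) ≡ true
        φ⁻²-lab = trans (sym (not-involutive _)) (cong not
                     (trans (sym (lab-opp _)) (trans (cong lab round) (lab-s d ds))))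

    g0 : (∃ λ d → face d ≡ outer × tail d ≡ s) → (∃ λ d → face d ≡ outer × tail d ≡ t) →
         G0 Q col lab s t
    g0 outer-s outer-t = s≢t s t s~t , s∈S , t∈S , outer-s , outer-t , lab-s , lab-t

theorem2 : (Q : Quadrangulation) → (c : ProperColouring Q) →
    ∃ λ lab → IsStrongLabeling Q (Σ.proj₁ c) lab
theorem2 Q c with Labelling.black-corner Q c (Quadrangulation.outer Q)
... | d , d-outer , black =
  lab , s , t
    , g0 (d , d-outer , refl) (φ (φ d) , trans (φ-face _) (trans (φ-face d) d-outer) , refl)
    , Counting.intervals Q c lab g2 s t some , g2 , g3
  where
  open Quadrangulation Q
  open Coloured Q c
  -- The two black corners of the outer face; that face is itself the edge from `s` to `t` with
  -- which the numbering begins.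
  s = tail d
  t = opp d
  s~t : Adj s t
  s~t = d , black , refl , refl
  open STNumbering Adj adj-sym s t
  h₀ = proj₁ (st-numbering s t s~t)
  open Labelling Q c
  -- Ties are broken so that every face gets an orientation.
  open Labelling.Oriented Q c s t s~t (breakTies h₀)
    (rescale (breakTies h₀) (breakTies-mono h₀) (proj₂ (st-numbering s t s~t))) (breakTies-injective h₀)
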